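{- Let $G$ be an isolate-free graph with maximum degree $\Delta(G)$ odd and $\Delta(G)\ge 5$, such that $TC(G)=\left\lfloor\frac{\Delta(G)^2}{4}+\Delta(G)+1\right\rfloor$. Then the total coalition graph of a total coalition partition of $G$ of maximum cardinality is determined up to isomorphism once the size of its maximum matching is fixed; that is, for any two total coalition partitions $\Psi,\Psi'$ of $G$ with $TC(G)$ classes each, if $\nu(TCG(G,\Psi))=\nu(TCG(G,\Psi'))$, then $TCG(G,\Psi)$ and $TCG(G,\Psi')$ are isomorphic.
   Context: All graphs are finite and simple (no loops or multiple edges). A graph is isolate-free if it has no vertex of degree $0$. $\nu(H)$ denotes the largest size of a matching in a graph $H$. A set $T\subseteq V$ of vertices of a graph $G(V,E)$ is a total dominating set if every vertex of $V$ is adjacent to at least one vertex of $T$. Two disjoint sets $A,B\subset V$ form a total coalition if neither $A$ nor $B$ is a total dominating set, but $A\cup B$ is. A total coalition partition of $G$ is a partition $\Psi=\{C_1,\dots,C_k\}$ of $V$ into non-empty classes such that for every $i$ there exists $j\neq i$ such that $C_i$ and $C_j$ form a total coalition. The total coalition number $TC(G)$ of an isolate-free graph $G$ is the maximum cardinality (number of classes) of a total coalition partition of $G$. For a total coalition partition $\Psi$ of $G$, the total coalition graph $TCG(G,\Psi)$ has the classes of $\Psi$ as vertices, two classes being adjacent if and only if they form a total coalition. -}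

module Defs where

open import Data.Fin.Base using (Fin)
open import Data.Fin.Properties using (all?; any?)
open import Data.Fin.Subset using (Subset; _∈_; _∪_; _∩_; ∣_∣; Nonempty; Empty)
open import Data.Fin.Subset.Properties using (_∈?_; ∪-comm; ∪-idem; ∩-comm; nonempty?)
open import Data.List.Base using (foldr; tabulate)
open import Data.Nat.Base using (ℕ; _≤_; _⊔_)
open import Data.Product.Base using (∃; _×_; _,_)
import Data.Vec.Base as Vec
open import Function.Bundles using (_↔_; _⇔_; Inverse)
open import Level using (0ℓ)
open import Relation.Binary.Core using (Rel)
open import Relation.Binary.Definitions using (Decidable; Irreflexive; Symmetric)
open import Relation.Binary.PropositionalEquality using (_≡_; _≢_; refl; subst)
open import Relation.Nullary using (¬_; Dec; does)
open import Relation.Nullary.Decidable using (_×-dec_; ¬?; map′)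

------------------------------------------------------------------------
-- Finite simple graphs

record Graph (n : ℕ) : Set₁ where
  field
    Adj         : Rel (Fin n) 0ℓ
    adj?        : Decidable Adj
    symmetric   : Symmetric Adj
    irreflexive : Irreflexive _≡_ Adj

  neighbours : Fin n → Subset n
  neighbours v = Vec.tabulate (λ u → does (adj? v u))

  degree : Fin n → ℕ
  degree v = ∣ neighbours v ∣

  -- The graph without vertices gets maximum degree 0.
  maxDegree : ℕ
  maxDegree = foldr _⊔_ 0 (tabulate degree)

  IsolateFree : Set
  IsolateFree = ∀ v → degree v ≢ 0

open Graph public

record _≅_ {m n : ℕ} (G : Graph m) (H : Graph n) : Set where
  field
    bijection : Fin m ↔ Fin n
    adjacency : ∀ u v → Adj G u v ⇔ Adj H (Inverse.to bijection u) (Inverse.to bijection v)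

IsMaximum : (ℕ → Set) → ℕ → Set
IsMaximum P k = P k × (∀ j → P j → j ≤ k)

------------------------------------------------------------------------
-- Matchings

-- A matching of size s, its edges being listed (and oriented) arbitrarily.
-- Distinct edges share no endpoint; in particular the list has no repetition.
record Matching {n : ℕ} (H : Graph n) (s : ℕ) : Set where
  field
    end₁ end₂ : Fin s → Fin n
    edge      : ∀ i → Adj H (end₁ i) (end₂ i)
    disjoint₁₁ : ∀ i j → i ≢ j → end₁ i ≢ end₁ j
    disjoint₁₂ : ∀ i j → i ≢ j → end₁ i ≢ end₂ j
    disjoint₂₂ : ∀ i j → i ≢ j → end₂ i ≢ end₂ j

-- "ν(H) = s"
IsMatchingNumber : {n : ℕ} → Graph n → ℕ → Set
IsMatchingNumber H = IsMaximum (Matching H)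

------------------------------------------------------------------------
-- Total coalitions

module _ {n : ℕ} (G : Graph n) where

  TotalDominating : Subset n → Set
  TotalDominating T = ∀ v → ∃ λ u → u ∈ T × Adj G v u

  record TotalCoalition (A B : Subset n) : Set where
    constructor totalCoalition
    field
      disjoint : Empty (A ∩ B)
      notLeft  : ¬ TotalDominating A
      notRight : ¬ TotalDominating B
      union    : TotalDominating (A ∪ B)

  -- A partition of the vertices into k classes, indexed in an arbitrary order.
  record TotalCoalitionPartition (k : ℕ) : Set where
    field
      class    : Fin k → Subset n
      nonempty : ∀ i → Nonempty (class i)
      disjoint : ∀ i j → i ≢ j → Empty (class i ∩ class j)
      covers   : ∀ v → ∃ λ i → v ∈ class i
      partner  : ∀ i → ∃ λ j → j ≢ i × TotalCoalition (class i) (class j)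

  -- "TC(G) = k"
  IsTotalCoalitionNumber : ℕ → Set
  IsTotalCoalitionNumber = IsMaximum TotalCoalitionPartition

  totalDominating? : ∀ T → Dec (TotalDominating T)
  totalDominating? T = all? λ v → any? λ u → (u ∈? T) ×-dec adj? G v u

  totalCoalition? : ∀ A B → Dec (TotalCoalition A B)
  totalCoalition? A B =
    map′ (λ (d , a , b , u) → totalCoalition d a b u)
         (λ (totalCoalition d a b u) → d , a , b , u)
         (¬? (nonempty? (A ∩ B)) ×-dec ¬? (totalDominating? A)
           ×-dec ¬? (totalDominating? B) ×-dec totalDominating? (A ∪ B))

  totalCoalition-sym : ∀ {A B} → TotalCoalition A B → TotalCoalition B A
  totalCoalition-sym {A} {B} (totalCoalition d a b u) =
    totalCoalition (subst Empty (∩-comm A B) d) b a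
                   (subst TotalDominating (∪-comm A B) u)

  totalCoalition-irrefl : ∀ {A} → ¬ TotalCoalition A A
  totalCoalition-irrefl {A} (totalCoalition _ a _ u) =
    a (subst TotalDominating (∪-idem A) u)

TCG : {n k : ℕ} (G : Graph n) → TotalCoalitionPartition G k → Graph k
TCG G Ψ = record
  { Adj         = λ i j → TotalCoalition G (class i) (class j)
  ; adj?        = λ i j → totalCoalition? G (class i) (class j)
  ; symmetric   = totalCoalition-sym G
  ; irreflexive = λ { refl → totalCoalition-irrefl G }
  }
  where open TotalCoalitionPartition Ψ

{-# OPTIONS --safe #-}
module Submission where

-- Fix a total coalition partition with coalition graph H, and for each vertex v of G let S v be the
-- set of classes meeting the neighbourhood of v.  Then |S v| ≤ Δ, each S v is a vertex cover of H,
-- every class is missed by some S v, and two classes are adjacent in H as soon as each S v contains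
-- one of them.
--
-- Let t = ν(H).  Since a maximum matching admits no augmenting path of length 1 or 3, H is spanned
-- by t disjoint stars, each containing a matching edge.  If S v misses the centre of a star, it
-- contains all the leaves of that star and at least one class of every other star, so that star has
-- at most q = Δ + 2 − t classes.  Hence k ≤ t q, and as k = (m + 1)(m + 2) for Δ = 2 m + 1, the
-- numbers t and q are m + 1 and m + 2 in some order and each star has exactly q classes.  The count
-- is then tight: an S v missing a centre contains just one class of every other star, its centre.
-- So leaves are adjacent to their own centre only, any two centres are adjacent, and H is determined
-- by t.

open import Defs
open import Data.Bool.Base using (Bool; true; false; if_then_else_)
import Data.Bool.Properties as Bool
open import Data.Empty using (⊥; ⊥-elim)
open import Data.Fin.Base using (Fin; zero; suc; punchIn; punchOut)
open import Data.Fin.Permutation using (Permutation; _⟨$⟩ʳ_; insert)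
import Data.Fin.Permutation as Permutation
open import Data.Fin.Properties using (_≟_; any?; all?; punchIn-punchOut; ¬∀⟶∃¬)
open import Data.Fin.Subset using (_∈_; _∪_; ∣_∣)
open import Data.Fin.Subset.Properties using (_∈?_; x∈p∩q⁺; x∈p∪q⁺; x∈p∪q⁻)
open import Data.List.Base using (foldr; tabulate)
open import Data.Nat.Base using (ℕ; zero; suc; _+_; _*_; _∸_; _^_; _≤_; _≥_; _/_; _%_; _⊔_; z≤n; s≤s)
open import Data.Nat.DivMod using (m≡m%n+[m/n]*n; +-distrib-/-∣ʳ; m*n/n≡m)
open import Data.Nat.Divisibility using (n∣m*n)
open import Data.Nat.Properties hiding (_≟_)
open import Data.Nat.Tactic.RingSolver using (solve-∀)
open import Data.Product.Base using (∃; _×_; _,_; proj₁; proj₂)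
open import Data.Product.Properties using (≡-dec)
open import Data.Sum.Base using (_⊎_; inj₁; inj₂; [_,_]′)
import Data.Sum.Base as Sum
open import Data.Unit.Base using (tt)
import Data.Vec.Base as Vec
open import Data.Vec.Functional using (updateAt)
open import Data.Vec.Functional.Properties using (updateAt-updates; updateAt-minimal)
open import Function.Base using (_∘_; const)
open import Function.Bundles using (_⇔_; mk⇔; Equivalence)
import Function.Properties.Equivalence as ⇔
open import Relation.Binary.Definitions using (DecidableEquality)
open import Relation.Binary.PropositionalEquality using (_≡_; _≢_; refl; sym; trans; cong; cong₂; subst; subst₂; module ≡-Reasoning)
open import Relation.Nullary using (¬_; Dec; yes; no; does; contradiction)
open import Relation.Nullary.Decidable using (_×-dec_; _⊎-dec_; ¬?; dec-true; dec-false; decidable-stable)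
open import Relation.Unary using (Decidable)

open import Algebra.Properties.CommutativeMonoid.Sum +-0-commutativeMonoid
  using (sum; ∑-comm; ∑-distrib-+; sum-remove; sum-cong-≗)

private variable
  k n s t : ℕ
  A : Set

-- Counting

sum-mono-≤ : {f g : Fin n → ℕ} → (∀ i → f i ≤ g i) → sum f ≤ sum g
sum-mono-≤ {zero}  f≤g = z≤n
sum-mono-≤ {suc n} f≤g = +-mono-≤ (f≤g zero) (sum-mono-≤ (f≤g ∘ suc))

sum-≤ : ∀ {q} {f : Fin n → ℕ} → (∀ i → f i ≤ q) → sum f ≤ n * q
sum-≤ {zero}  f≤q = z≤n
sum-≤ {suc n} f≤q = +-mono-≤ (f≤q zero) (sum-≤ (f≤q ∘ suc))

n≤sum : {f : Fin n → ℕ} → (∀ i → 1 ≤ f i) → n ≤ sum f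
n≤sum {zero}  1≤f = z≤n
n≤sum {suc n} 1≤f = +-mono-≤ (1≤f zero) (n≤sum (1≤f ∘ suc))

-- The other n - 1 terms contribute at least one each; the `1 +` on the right replaces that
-- subtraction.
sum-lower₁ : {f : Fin n → ℕ} → (∀ i → 1 ≤ f i) → ∀ i → n + f i ≤ 1 + sum f
sum-lower₁ {suc n} {f} 1≤f i = s≤s (begin
  n + f i                     ≡⟨ +-comm n (f i) ⟩
  f i + n                     ≤⟨ +-monoʳ-≤ (f i) (n≤sum (1≤f ∘ punchIn i)) ⟩
  f i + sum (f ∘ punchIn i)   ≡⟨ sum-remove f ⟨
  sum f                       ∎)
  where open ≤-Reasoning

sum-lower₂ : {f : Fin n → ℕ} → (∀ i → 1 ≤ f i) → ∀ {i j} → i ≢ j →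
             n + (f i + f j) ≤ 2 + sum f
sum-lower₂ {suc n} {f} 1≤f {i} {j} i≢j = s≤s (begin
  n + (f i + f j)                              ≡⟨ rotate n (f i) (f j) ⟩
  f i + (n + f j)                              ≡⟨ cong (λ x → f i + (n + f x)) (punchIn-punchOut i≢j) ⟨
  f i + (n + f (punchIn i (punchOut i≢j)))     ≤⟨ +-monoʳ-≤ (f i) (sum-lower₁ (1≤f ∘ punchIn i) (punchOut i≢j)) ⟩
  f i + (1 + sum (f ∘ punchIn i))              ≡⟨ +-suc (f i) _ ⟩
  1 + (f i + sum (f ∘ punchIn i))              ≡⟨ cong suc (sum-remove f) ⟨
  1 + sum f                                    ∎)
  where
  open ≤-Reasoning
  rotate : ∀ a b c → a + (b + c) ≡ b + (a + c)
  rotate = solve-∀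

-- A term below `q` could not be compensated, since the remaining terms are at most `q` each.
sum-extremal : ∀ {q} {f : Fin n → ℕ} → (∀ i → f i ≤ q) → sum f ≡ n * q → ∀ i → f i ≡ q
sum-extremal {suc n} {q} {f} f≤q eq i = ≤-antisym (f≤q i) (+-cancelʳ-≤ (n * q) q (f i) (begin
  q + n * q                   ≡⟨ eq ⟨
  sum f                       ≡⟨ sum-remove f ⟩
  f i + sum (f ∘ punchIn i)   ≤⟨ +-monoʳ-≤ (f i) (sum-≤ (f≤q ∘ punchIn i)) ⟩
  f i + n * q                 ∎))
  where open ≤-Reasoning

indicator : Dec A → ℕ
indicator A? = if does A? then 1 else 0

count : {P : Fin n → Set} → Decidable P → ℕ
count P? = sum (λ i → indicator (P? i))

module _ {P Q : Fin n → Set} (P? : Decidable P) (Q? : Decidable Q) where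

  count-mono : (∀ {i} → P i → Q i) → count P? ≤ count Q?
  count-mono P⊆Q = sum-mono-≤ pointwise
    where
    pointwise : ∀ i → indicator (P? i) ≤ indicator (Q? i)
    pointwise i with P? i | Q? i
    ... | yes p | yes q = ≤-refl
    ... | yes p | no ¬q = contradiction (P⊆Q p) ¬q
    ... | no ¬p | _     = z≤n

  count-cong : (∀ {i} → P i ⇔ Q i) → count P? ≡ count Q?
  count-cong P⇔Q = sum-cong-≗ pointwise
    where
    pointwise : ∀ i → indicator (P? i) ≡ indicator (Q? i)
    pointwise i with P? i | Q? i
    ... | yes p | yes q = refl
    ... | yes p | no ¬q = contradiction (Equivalence.to P⇔Q p) ¬q
    ... | no ¬p | yes q = contradiction (Equivalence.from P⇔Q q) ¬p
    ... | no ¬p | no ¬q = refl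

  module _ {R : Fin n → Set} (R? : Decidable R) where

    count-∪-≤ : (∀ {i} → R i → P i ⊎ Q i) → count R? ≤ count P? + count Q?
    count-∪-≤ R⊆P∪Q = ≤-trans (sum-mono-≤ pointwise) (≤-reflexive (∑-distrib-+ (indicator ∘ P?) (indicator ∘ Q?)))
      where
      pointwise : ∀ i → indicator (R? i) ≤ indicator (P? i) + indicator (Q? i)
      pointwise i with R? i | P? i | Q? i
      ... | no ¬r | _     | _     = z≤n
      ... | yes r | yes p | _     = s≤s z≤n
      ... | yes r | no ¬p | yes q = s≤s z≤n
      ... | yes r | no ¬p | no ¬q = contradiction (R⊆P∪Q r) [ ¬p , ¬q ]′

    count-⊎-≤ : (∀ {i} → P i → Q i → ⊥) → (∀ {i} → P i ⊎ Q i → R i) →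
                count P? + count Q? ≤ count R?
    count-⊎-≤ disjoint P∪Q⊆R = ≤-trans (≤-reflexive (sym (∑-distrib-+ (indicator ∘ P?) (indicator ∘ Q?)))) (sum-mono-≤ pointwise)
      where
      pointwise : ∀ i → indicator (P? i) + indicator (Q? i) ≤ indicator (R? i)
      pointwise i with P? i | Q? i | R? i
      ... | yes p | yes q | _     = ⊥-elim (disjoint p q)
      ... | yes p | no ¬q | yes r = s≤s z≤n
      ... | no ¬p | yes q | yes r = s≤s z≤n
      ... | no ¬p | no ¬q | _     = z≤n
      ... | yes p | no ¬q | no ¬r = contradiction (P∪Q⊆R (inj₁ p)) ¬r
      ... | no ¬p | yes q | no ¬r = contradiction (P∪Q⊆R (inj₂ q)) ¬r

count-none : {P : Fin n → Set} (P? : Decidable P) → (∀ i → ¬ P i) → count P? ≡ 0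
count-none {zero}  P? ¬P = refl
count-none {suc n} P? ¬P rewrite dec-false (P? zero) (¬P zero) = count-none (P? ∘ suc) (¬P ∘ suc)

count-all : ∀ n → count {n} (λ _ → yes tt) ≡ n
count-all zero    = refl
count-all (suc n) = cong suc (count-all n)

count-≟ : (i : Fin n) → count (_≟ i) ≡ 1
count-≟ {suc n} zero    = cong suc (count-none {n} {P = λ j → suc j ≡ zero} (λ j → suc j ≟ zero) (λ _ ()))
count-≟ (suc i) = trans
  (count-cong (λ j → suc j ≟ suc i) (_≟ i) (mk⇔ (λ { refl → refl }) (λ { refl → refl })))
  (count-≟ i)

module _ {P : Fin n → Set} (P? : Decidable P) where

  count-unique : ∀ {i} → P i → (∀ {j} → P j → j ≡ i) → count P? ≡ 1
  count-unique {i} p unique =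
    trans (count-cong P? (_≟ i) (mk⇔ unique (λ { refl → p }))) (count-≟ i)

  count-some : ∀ {i} → P i → 1 ≤ count P?
  count-some {i} p =
    ≤-trans (≤-reflexive (sym (count-≟ i))) (count-mono (_≟ i) P? (λ { refl → p }))

  count-two : ∀ {i j} → i ≢ j → P i → P j → 2 ≤ count P?
  count-two {i} {j} i≢j p p′ = ≤-trans
    (≤-reflexive (sym (cong₂ _+_ (count-≟ i) (count-≟ j))))
    (count-⊎-≤ (_≟ i) (_≟ j) P? (λ { refl refl → i≢j refl }) [ (λ { refl → p }) , (λ { refl → p′ }) ]′)

  -- Double counting: each element of `P` lies in exactly one fibre of `g`, and the two sums are
  -- exchanged.
  count-fibres : (g : Fin n → Fin t) →
                 count P? ≡ sum (λ i → count (λ a → P? a ×-dec (g a ≟ i)))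
  count-fibres {t} g = trans (sum-cong-≗ pointwise) (∑-comm (λ a i → indicator (P? a ×-dec (g a ≟ i))))
    where
    pointwise : ∀ a → indicator (P? a) ≡ count (λ i → P? a ×-dec (g a ≟ i))
    pointwise a with P? a
    ... | yes p = sym (trans
                    (count-cong (λ i → yes p ×-dec (g a ≟ i)) (_≟ g a) (mk⇔ (sym ∘ proj₂) (λ e → p , sym e)))
                    (count-≟ (g a)))
    ... | no ¬p = sym (count-none (λ i → no ¬p ×-dec (g a ≟ i)) (λ _ → ¬p ∘ proj₁))

∣tabulate∣≡count : {P : Fin n → Set} (P? : Decidable P) → ∣ Vec.tabulate (does ∘ P?) ∣ ≡ count P?
∣tabulate∣≡count {zero}  P? = refl
∣tabulate∣≡count {suc n} P? with does (P? zero)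
... | true  = cong suc (∣tabulate∣≡count (P? ∘ suc))
... | false = ∣tabulate∣≡count (P? ∘ suc)

-- Permutations carrying one labelling to another

module _ (_≟ᴬ_ : DecidableEquality A) where

  -- By induction on `k`: `zero` is sent to some `j` with the same label, and deleting both keeps
  -- the fibre counts equal. This yields isomorphisms between graphs whose adjacency depends only on
  -- labels.
  equal-fibres⇒permutation :
    (f g : Fin k → A) → (∀ x → count (λ a → f a ≟ᴬ x) ≡ count (λ a → g a ≟ᴬ x)) →
    ∃ λ (π : Permutation k k) → ∀ a → g (π ⟨$⟩ʳ a) ≡ f a
  equal-fibres⇒permutation {zero}  f g eq = Permutation.id , λ ()
  equal-fibres⇒permutation {suc k} f g eq with any? (λ j → g j ≟ᴬ f zero)
  ... | no ∄j = contradiction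
          (trans (eq (f zero)) (count-none (λ a → g a ≟ᴬ f zero) (λ j e → ∄j (j , e))))
          (>⇒≢ (count-some (λ a → f a ≟ᴬ f zero) {zero} refl))
  ... | yes (j , gj≡f0) = insert zero j (proj₁ rec) , λ { zero → gj≡f0 ; (suc a) → proj₂ rec a }
    where
    eq′ : ∀ x → count (λ a → f (suc a) ≟ᴬ x) ≡ count (λ a → g (punchIn j a) ≟ᴬ x)
    eq′ x = +-cancelˡ-≡ (indicator (f zero ≟ᴬ x)) _ _ (begin
      indicator (f zero ≟ᴬ x) + count (λ a → f (suc a) ≟ᴬ x)        ≡⟨ eq x ⟩
      count (λ a → g a ≟ᴬ x)                                        ≡⟨ sum-remove {i = j} (λ a → indicator (g a ≟ᴬ x)) ⟩
      indicator (g j ≟ᴬ x) + count (λ a → g (punchIn j a) ≟ᴬ x)     ≡⟨ cong (λ y → indicator (y ≟ᴬ x) + _) gj≡f0 ⟩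
      indicator (f zero ≟ᴬ x) + count (λ a → g (punchIn j a) ≟ᴬ x)  ∎)
      where open ≡-Reasoning
    rec = equal-fibres⇒permutation (f ∘ suc) (g ∘ punchIn j) eq′

-- Maximum matchings

-- Only the spokes are required to be edges; `H` may have any further edges within or between stars.
-- The size bound gives every star a leaf.
record StarForest (H : Graph k) (t : ℕ) : Set where
  field
    star        : Fin k → Fin t
    centre      : Fin t → Fin k
    star-centre : ∀ i → star (centre i) ≡ i
    spoke       : ∀ {a} → a ≢ centre (star a) → Adj H a (centre (star a))
    2≤size      : ∀ i → 2 ≤ count (λ a → star a ≟ i)

module _ {H : Graph k} where

  record Free (M : Matching H s) (a : Fin k) : Set where
    constructor free
    open Matching M
    field
      ≢end₁ : ∀ e → end₁ e ≢ a
      ≢end₂ : ∀ e → end₂ e ≢ a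

  open Free

  extend : (M : Matching H s) → ∀ {a b} → Free M a → Free M b → Adj H a b → Matching H (suc s)
  extend M {a} {b} fa fb a~b = record
    { end₁ = λ { zero → a ; (suc e) → end₁ e }
    ; end₂ = λ { zero → b ; (suc e) → end₂ e }
    ; edge = λ { zero → a~b ; (suc e) → edge e }
    ; disjoint₁₁ = λ
      { zero    zero    i≢j → contradiction refl i≢j
      ; zero    (suc j) _   → ≢end₁ fa j ∘ sym
      ; (suc i) zero    _   → ≢end₁ fa i
      ; (suc i) (suc j) i≢j → disjoint₁₁ i j (i≢j ∘ cong suc)
      }
    ; disjoint₁₂ = λ
      { zero    zero    i≢j → contradiction refl i≢j
      ; zero    (suc j) _   → ≢end₂ fa j ∘ sym
      ; (suc i) zero    _   → ≢end₁ fb i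
      ; (suc i) (suc j) i≢j → disjoint₁₂ i j (i≢j ∘ cong suc)
      }
    ; disjoint₂₂ = λ
      { zero    zero    i≢j → contradiction refl i≢j
      ; zero    (suc j) _   → ≢end₂ fb j ∘ sym
      ; (suc i) zero    _   → ≢end₂ fb i
      ; (suc i) (suc j) i≢j → disjoint₂₂ i j (i≢j ∘ cong suc)
      }
    }
    where open Matching M

  -- First half of an augmentation of length 3: the edge `e` is turned from `end₂ e` to the free
  -- vertex `a`, which releases `end₂ e`.
  module Replace (M : Matching H s) (e : Fin s) {a : Fin k} (fa : Free M a)
                 (e~a : Adj H (Matching.end₁ M e) a) where
    open Matching M

    end₂′ : Fin s → Fin k
    end₂′ = updateAt end₂ e (const a)

    -- A single case split on `i ≟ e` then serves all the fields that mention `end₂′`.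
    end₂′-elim : (C : Fin s → Fin k → Set) → C e a → (∀ i → i ≢ e → C i (end₂ i)) → ∀ i → C i (end₂′ i)
    end₂′-elim C new old i with i ≟ e
    ... | yes refl = subst (C e) (sym (updateAt-updates e end₂)) new
    ... | no i≢e   = subst (C i) (sym (updateAt-minimal i e end₂ i≢e)) (old i i≢e)

    replace : Matching H s
    replace = record
      { end₁ = end₁
      ; end₂ = end₂′
      ; edge = end₂′-elim (λ i x → Adj H (end₁ i) x) e~a (λ i _ → edge i)
      ; disjoint₁₁ = disjoint₁₁
      ; disjoint₁₂ = λ i → end₂′-elim (λ j x → i ≢ j → end₁ i ≢ x)
          (λ _ → ≢end₁ fa i) (λ j _ → disjoint₁₂ i j)
      ; disjoint₂₂ = λ i j → end₂′-elim (λ i x → i ≢ j → x ≢ end₂′ j)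
          (end₂′-elim (λ j x → e ≢ j → a ≢ x)
            (contradiction refl) (λ j _ _ → ≢end₂ fa j ∘ sym) j)
          (λ i _ → end₂′-elim (λ j x → i ≢ j → end₂ i ≢ x)
            (λ _ → ≢end₂ fa i) (λ j _ → disjoint₂₂ i j) j)
          i
      }

    free-end₂ : Free replace (end₂ e)
    free-end₂ = free
      -- If `end₁ i` equalled `end₂ e`, disjointness would force i = e, and the edge `e` would be a
      -- loop.
      (λ i p → irreflexive H p (subst (λ j → Adj H (end₁ j) (end₂ e)) (e≡ i p) (edge e)))
      (end₂′-elim (λ _ x → x ≢ end₂ e) (≢end₂ fa e ∘ sym) (λ i → disjoint₂₂ i e))
      where
      e≡ : ∀ i → end₁ i ≡ end₂ e → e ≡ i
      e≡ i p = sym (decidable-stable (i ≟ e) (λ i≢e → disjoint₁₂ i e i≢e p))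

    free-other : ∀ {u} → Free M u → a ≢ u → Free replace u
    free-other fu a≢u = free (≢end₁ fu) (end₂′-elim (λ _ x → x ≢ _) a≢u (λ i _ → ≢end₂ fu i))

module MaximumMatching
  {H : Graph k} (neighbour : ∀ a → ∃ λ b → Adj H a b)
  (M : Matching H s) (maximum : ¬ Matching H (suc s)) where

  open Matching M

  data Attached (a : Fin k) (e : Fin s) : Set where
    is₁ : a ≡ end₁ e → Attached a e
    is₂ : a ≡ end₂ e → Attached a e
    to₁ : Free M a → Adj H a (end₁ e) → Attached a e
    to₂ : Free M a → Adj H a (end₂ e) → Attached a e

  covered? : ∀ a → Free M a ⊎ (∃ λ e → end₁ e ≡ a ⊎ end₂ e ≡ a)
  covered? a with any? (λ e → (end₁ e ≟ a) ⊎-dec (end₂ e ≟ a))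
  ... | yes c = inj₂ c
  ... | no ¬c = inj₁ (free (λ e p → ¬c (e , inj₁ p)) (λ e p → ¬c (e , inj₂ p)))

  -- A free vertex has a neighbour, which must be matched: an edge between two free vertices would
  -- enlarge the maximum matching.
  attach : ∀ a → ∃ (Attached a)
  attach a with covered? a
  ... | inj₂ (e , inj₁ p) = e , is₁ (sym p)
  ... | inj₂ (e , inj₂ p) = e , is₂ (sym p)
  ... | inj₁ fa with neighbour a
  ...   | b , a~b with covered? b
  ...     | inj₁ fb              = contradiction (extend M fa fb a~b) maximum
  ...     | inj₂ (e , inj₁ refl) = e , to₁ fa a~b
  ...     | inj₂ (e , inj₂ refl) = e , to₂ fa a~b

  star : Fin k → Fin s
  star a = proj₁ (attach a)

  -- Matching edges are disjoint and a matched vertex is not free, so only its own edge can be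
  -- attached to it.
  attached-end₁ : ∀ {e i} → Attached (end₁ e) i → i ≡ e
  attached-end₁ {e} {i} (is₁ p)   = decidable-stable (i ≟ e) (λ i≢e → disjoint₁₁ i e i≢e (sym p))
  attached-end₁ {e} {i} (is₂ p)   = decidable-stable (i ≟ e) (λ i≢e → disjoint₁₂ e i (i≢e ∘ sym) p)
  attached-end₁ {e} {i} (to₁ f _) = contradiction refl (Free.≢end₁ f e)
  attached-end₁ {e} {i} (to₂ f _) = contradiction refl (Free.≢end₁ f e)

  attached-end₂ : ∀ {e i} → Attached (end₂ e) i → i ≡ e
  attached-end₂ {e} {i} (is₁ p)   = decidable-stable (i ≟ e) (λ i≢e → disjoint₁₂ i e i≢e (sym p))
  attached-end₂ {e} {i} (is₂ p)   = decidable-stable (i ≟ e) (λ i≢e → disjoint₂₂ i e i≢e (sym p))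
  attached-end₂ {e} {i} (to₁ f _) = contradiction refl (Free.≢end₂ f e)
  attached-end₂ {e} {i} (to₂ f _) = contradiction refl (Free.≢end₂ f e)

  star-end₁ : ∀ e → star (end₁ e) ≡ e
  star-end₁ e = attached-end₁ (proj₂ (attach (end₁ e)))

  star-end₂ : ∀ e → star (end₂ e) ≡ e
  star-end₂ e = attached-end₂ (proj₂ (attach (end₂ e)))

  -- Free neighbours a of end₁ e and u ≠ a of end₂ e would give the augmenting path a, end₁ e, end₂ e, u.
  no-augmenting-path : ∀ {e a u} → Free M a → Free M u → Adj H a (end₁ e) → Adj H u (end₂ e) → a ≡ u
  no-augmenting-path {e} {a} {u} fa fu a~ u~ with a ≟ u
  ... | yes a≡u = a≡u
  ... | no a≢u  = contradiction
        (extend replace free-end₂ (free-other fu a≢u) (symmetric H u~)) maximum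
    where open Replace M e fa (symmetric H a~)

  -- Freeness is unfolded here into a form that `all?` can decide.
  Pendant₂ : Fin s → Fin k → Set
  Pendant₂ e u = (∀ i → end₁ i ≢ u × end₂ i ≢ u) × Adj H u (end₂ e)

  pendant₂? : ∀ e → Decidable (Pendant₂ e)
  pendant₂? e u = all? (λ i → ¬? (end₁ i ≟ u) ×-dec ¬? (end₂ i ≟ u)) ×-dec adj? H u (end₂ e)

  -- The centre is `end₂ e` exactly when some free vertex hangs on `end₂ e`; otherwise all free
  -- vertices attached to `e` hang on `end₁ e`.
  chooseCentre : ∀ e → ∃ λ c → (c ≡ end₁ e ⊎ c ≡ end₂ e) × (∀ {a} → Attached a e → a ≢ c → Adj H a c)
  chooseCentre e with any? (pendant₂? e)
  ... | no ∄ = end₁ e , inj₁ refl , λ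
        { (is₁ refl)       a≢c → contradiction refl a≢c
        ; (is₂ refl)       _   → symmetric H (edge e)
        ; (to₁ _ a~)       _   → a~
        ; (to₂ f a~)       _   → contradiction (_ , (λ i → Free.≢end₁ f i , Free.≢end₂ f i) , a~) ∄
        }
  ... | yes (u , fu , u~) = end₂ e , inj₂ refl , λ
        { (is₁ refl)       _   → edge e
        ; (is₂ refl)       a≢c → contradiction refl a≢c
        -- A free neighbour of `end₁ e` must be `u` itself, hence is adjacent to `end₂ e` as well.
        ; (to₁ f a~)       _   → subst (λ x → Adj H x (end₂ e))
                                   (sym (no-augmenting-path f (free (proj₁ ∘ fu) (proj₂ ∘ fu)) a~ u~)) u~
        ; (to₂ _ a~)       _   → a~
        }

  starForest : StarForest H s
  starForest = record
    { star        = star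
    ; centre      = proj₁ ∘ chooseCentre
    ; star-centre = λ e → [ (λ p → trans (cong star p) (star-end₁ e))
                          , (λ p → trans (cong star p) (star-end₂ e)) ]′ (proj₁ (proj₂ (chooseCentre e)))
    ; spoke       = λ {a} → proj₂ (proj₂ (chooseCentre (star a))) (proj₂ (attach a))
    ; 2≤size      = λ e → count-two (λ a → star a ≟ e)
                      (λ p → irreflexive H p (edge e)) (star-end₁ e) (star-end₂ e)
    }

-- Graphs whose adjacency is governed by small vertex covers

-- The clique on Fin t with pendant vertices attached: (i , true) is the i-th clique vertex, and every
-- pendant vertex at it has the label (i , false).
Corona : (x y : Fin t × Bool) → Set
Corona (i , x) (j , y) = (x ≡ true × y ≡ true × i ≢ j) ⊎ (i ≡ j × x ≢ y)

_≟ᴸ_ : DecidableEquality (Fin t × Bool)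
_≟ᴸ_ = ≡-dec _≟_ Bool._≟_

-- All that the argument retains of G: an index is a vertex v of G, and `Meets v a` says that class
-- `a` contains a neighbour of v.
record CoverFamily (H : Graph k) (Δ : ℕ) : Set₁ where
  field
    Index  : Set
    Meets  : Index → Fin k → Set
    meets? : ∀ v → Decidable (Meets v)
    small  : ∀ v → count (meets? v) ≤ Δ
    covers : ∀ v {a b} → Adj H a b → Meets v a ⊎ Meets v b
    missed : ∀ a → ∃ λ v → ¬ Meets v a
    joined : ∀ {a b} → a ≢ b → (∀ v → Meets v a ⊎ Meets v b) → Adj H a b

module CoveredStars {H : Graph k} (F : StarForest H t) {Δ : ℕ} (C : CoverFamily H Δ) where
  open StarForest F
  open CoverFamily C

  size : Fin t → ℕ
  size i = count (λ a → star a ≟ i)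

  met : Index → Fin t → ℕ
  met v i = count (λ a → meets? v a ×-dec (star a ≟ i))

  sum-size : sum size ≡ k
  sum-size = sym (begin
    k                                                    ≡⟨ count-all k ⟨
    count {k} (λ _ → yes tt)                             ≡⟨ count-fibres (λ _ → yes tt) star ⟩
    sum (λ i → count (λ a → yes tt ×-dec (star a ≟ i)))  ≡⟨ sum-cong-≗ (λ i → count-cong
                                                              (λ a → yes tt ×-dec (star a ≟ i)) (λ a → star a ≟ i)
                                                              (mk⇔ proj₂ (tt ,_))) ⟩
    sum size                                             ∎)
    where open ≡-Reasoning

  sum-met≤Δ : ∀ v → sum (met v) ≤ Δ
  sum-met≤Δ v = ≤-trans (≤-reflexive (sym (count-fibres (meets? v) star))) (small v)

  -- Every spoke must be covered, so missing the centre forces all leaves to be met.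
  size≤1+met : ∀ {v i} → ¬ Meets v (centre i) → size i ≤ 1 + met v i
  size≤1+met {v} {i} c∉v = ≤-trans
    (count-∪-≤ (_≟ centre i) (λ a → meets? v a ×-dec (star a ≟ i)) (λ a → star a ≟ i) split)
    (≤-reflexive (cong (_+ met v i) (count-≟ (centre i))))
    where
    split : ∀ {a} → star a ≡ i → a ≡ centre i ⊎ Meets v a × star a ≡ i
    split {a} refl with a ≟ centre i
    ... | yes a≡c = inj₁ a≡c
    ... | no a≢c  = inj₂ ([ (λ a∈v → a∈v) , (λ c∈v → contradiction c∈v c∉v) ]′ (covers v (spoke a≢c)) , refl)

  1≤met : ∀ v i → 1 ≤ met v i
  1≤met v i with meets? v (centre i)
  ... | yes c∈v = count-some (λ a → meets? v a ×-dec (star a ≟ i)) (c∈v , star-centre i)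
  ... | no c∉v  = ≤-pred (≤-trans (2≤size i) (size≤1+met c∉v))

  -- For a `v` missing the centre, star `i` contributes at least its size less one and each other
  -- star at least one, within a total of `Δ`.
  t+size≤2+Δ : ∀ i → t + size i ≤ 2 + Δ
  t+size≤2+Δ i with missed (centre i)
  ... | v , c∉v = begin
    t + size i           ≤⟨ +-monoʳ-≤ t (size≤1+met c∉v) ⟩
    t + (1 + met v i)    ≡⟨ +-suc t (met v i) ⟩
    1 + (t + met v i)    ≤⟨ s≤s (sum-lower₁ (1≤met v) i) ⟩
    2 + sum (met v)      ≤⟨ s≤s (s≤s (sum-met≤Δ v)) ⟩
    2 + Δ                ∎
    where open ≤-Reasoning

  -- The bound `3≤q` prevents a cover from missing two centres, and `3≤t` supplies a star different
  -- from two given ones.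
  module Extremal {q : ℕ} (t+q≡2+Δ : t + q ≡ 2 + Δ) (size≡q : ∀ i → size i ≡ q)
                  (3≤t : 3 ≤ t) (3≤q : 3 ≤ q) where

    -- Star `i` already uses q - 1 of the `Δ` = (q - 1) + (t - 1) available places, leaving exactly
    -- one for each other star.
    met≤1 : ∀ {v i j} → ¬ Meets v (centre i) → i ≢ j → met v j ≤ 1
    met≤1 {v} {i} {j} c∉v i≢j = +-cancelˡ-≤ (t + met v i) (met v j) 1 (begin
      t + met v i + met v j      ≡⟨ +-assoc t (met v i) (met v j) ⟩
      t + (met v i + met v j)    ≤⟨ sum-lower₂ (1≤met v) i≢j ⟩
      2 + sum (met v)            ≤⟨ s≤s (s≤s (sum-met≤Δ v)) ⟩
      2 + Δ                      ≡⟨ t+q≡2+Δ ⟨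
      t + q                      ≡⟨ cong (t +_) (size≡q i) ⟨
      t + size i                 ≤⟨ +-monoʳ-≤ t (size≤1+met c∉v) ⟩
      t + (1 + met v i)          ≡⟨ cong (t +_) (+-comm 1 (met v i)) ⟩
      t + (met v i + 1)          ≡⟨ +-assoc t (met v i) 1 ⟨
      t + met v i + 1            ∎)
      where open ≤-Reasoning

    other-centre-met : ∀ {v i j} → ¬ Meets v (centre i) → i ≢ j → Meets v (centre j)
    other-centre-met {v} {i} {j} c∉v i≢j = decidable-stable (meets? v (centre j)) λ c′∉v →
      -- If the centre of star `j` were missed too, its q - 1 leaves would all be met, but at most
      -- one may be.
      <⇒≱ 3≤q (≤-trans (≤-reflexive (sym (size≡q j)))
                (≤-trans (size≤1+met c′∉v) (s≤s (met≤1 c∉v i≢j))))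

    -- The single place of that star is already taken by its centre.
    other-leaf-missed : ∀ {v i a} → ¬ Meets v (centre i) → i ≢ star a → a ≢ centre (star a) → ¬ Meets v a
    other-leaf-missed {v} {i} {a} c∉v i≢ a≢c a∈v = <⇒≱
      (count-two (λ b → meets? v b ×-dec (star b ≟ star a)) a≢c
        (a∈v , refl) (other-centre-met c∉v i≢ , star-centre (star a)))
      (met≤1 c∉v i≢)

    centres-adjacent : ∀ {i j} → i ≢ j → Adj H (centre i) (centre j)
    centres-adjacent {i} {j} i≢j =
      joined (λ p → i≢j (trans (sym (star-centre i)) (trans (cong star p) (star-centre j)))) meets
      where
      meets : ∀ v → Meets v (centre i) ⊎ Meets v (centre j)
      meets v with meets? v (centre i)
      ... | yes c∈v = inj₁ c∈v
      ... | no c∉v  = inj₂ (other-centre-met c∉v i≢j)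

    third : ∀ i j → ∃ λ l → l ≢ i × l ≢ j
    third i j with any? (λ l → ¬? (l ≟ i) ×-dec ¬? (l ≟ j))
    ... | yes l = l
    ... | no ∄l = contradiction
      (≤-trans (≤-reflexive (sym (count-all t)))
        (≤-trans (count-∪-≤ {n = t} (_≟ i) (_≟ j) (λ _ → yes tt) (λ {l} _ → i-or-j l))
                 (≤-reflexive (cong₂ _+_ (count-≟ i) (count-≟ j)))))
      (<⇒≱ 3≤t)
      where
      i-or-j : ∀ l → l ≡ i ⊎ l ≡ j
      i-or-j l with l ≟ i | l ≟ j
      ... | yes p | _     = inj₁ p
      ... | no  _ | yes p = inj₂ p
      ... | no ¬p | no ¬q = contradiction (l , ¬p , ¬q) ∄l

    Leaf : Fin k → Set
    Leaf a = a ≢ centre (star a)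

    -- A cover missing the centre of a third star misses both leaves, so it could not cover an edge
    -- between them.
    leaves-nonadjacent : ∀ {a b} → Leaf a → Leaf b → ¬ Adj H a b
    leaves-nonadjacent {a} {b} la lb a~b with third (star a) (star b)
    ... | l , l≢a , l≢b with missed (centre l)
    ...   | v , c∉v = [ other-leaf-missed c∉v l≢a la , other-leaf-missed c∉v l≢b lb ]′ (covers v a~b)

    centre~leaf⇒same-star : ∀ {i b} → Leaf b → Adj H (centre i) b → i ≡ star b
    centre~leaf⇒same-star {i} {b} lb c~b with missed (centre i)
    ... | v , c∉v = decidable-stable (i ≟ star b) λ i≢ →
          [ c∉v , other-leaf-missed c∉v i≢ lb ]′ (covers v c~b)

    label : Fin k → Fin t × Bool
    label a = star a , does (a ≟ centre (star a))

    adjacent⇔corona : ∀ a b → Adj H a b ⇔ Corona (label a) (label b)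
    adjacent⇔corona a b with a ≟ centre (star a) | b ≟ centre (star b)
    ... | yes p | yes q = mk⇔
      (λ a~b → inj₁ (refl , refl , λ e → irreflexive H (trans p (trans (cong centre e) (sym q))) a~b))
      [ (λ (_ , _ , i≢j) → subst₂ (Adj H) (sym p) (sym q) (centres-adjacent i≢j))
      , (λ (_ , x≢x) → contradiction refl x≢x) ]′
    ... | yes p | no lb = mk⇔
      (λ a~b → inj₂ (centre~leaf⇒same-star lb (subst (λ x → Adj H x b) p a~b) , λ ()))
      [ (λ ()) , (λ (e , _) → subst (λ x → Adj H x b) (sym (trans p (cong centre e))) (symmetric H (spoke lb))) ]′
    ... | no la | yes q = mk⇔
      (λ a~b → inj₂ (sym (centre~leaf⇒same-star la (subst (λ x → Adj H x a) q (symmetric H a~b))) , λ ()))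
      [ (λ ()) , (λ (e , _) → subst (Adj H a) (trans (cong centre e) (sym q)) (spoke la)) ]′
    ... | no la | no lb = mk⇔
      (λ a~b → contradiction a~b (leaves-nonadjacent la lb))
      [ (λ ()) , (λ (_ , x≢x) → contradiction refl x≢x) ]′

    label≡centre : ∀ {a i} → label a ≡ (i , true) → a ≡ centre i
    label≡centre {a} eq with a ≟ centre (star a)
    label≡centre refl | yes p = p

    count-label : ∀ i x → count (λ a → label a ≟ᴸ (i , x)) ≡ (if x then 1 else q ∸ 1)
    count-label i true = count-unique (λ a → label a ≟ᴸ (i , true)) label-centre label≡centre
      where
      label-centre : label (centre i) ≡ (i , true)
      label-centre = cong₂ _,_ (star-centre i)
        (dec-true (centre i ≟ centre (star (centre i))) (cong centre (sym (star-centre i))))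
    -- A star has `q` members, one of which is the centre; the rest are its leaves.
    count-label i false = cong (_∸ 1) (begin
      1 + leaves       ≡⟨ cong (_+ leaves) (count-label i true) ⟨
      centres + leaves ≡⟨ ≤-antisym
                           (count-⊎-≤ C? L? (λ a → star a ≟ i)
                             (λ p q → contradiction (trans (sym p) q) (λ ())) [ cong proj₁ , cong proj₁ ]′)
                           (count-∪-≤ C? L? (λ a → star a ≟ i) split) ⟩
      size i           ≡⟨ size≡q i ⟩
      q                ∎)
      where
      open ≡-Reasoning
      C? = λ a → label a ≟ᴸ (i , true)
      L? = λ a → label a ≟ᴸ (i , false)
      centres = count C?
      leaves  = count L?
      split : ∀ {a} → star a ≡ i → label a ≡ (i , true) ⊎ label a ≡ (i , false)
      split {a} refl with does (a ≟ centre (star a))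
      ... | true  = inj₁ refl
      ... | false = inj₂ refl

-- Coalition graphs

degree≤maxDegree : (G : Graph n) → ∀ v → degree G v ≤ maxDegree G
degree≤maxDegree {n} G = ≤-foldr (degree G)
  where
  ≤-foldr : ∀ {n} (f : Fin n → ℕ) i → f i ≤ foldr _⊔_ 0 (tabulate f)
  ≤-foldr f zero    = m≤m⊔n _ _
  ≤-foldr f (suc i) = ≤-trans (≤-foldr (f ∘ suc) i) (m≤n⊔m (f zero) _)

module _ (G : Graph n) (Ψ : TotalCoalitionPartition G k) where
  open TotalCoalitionPartition Ψ

  partner-adjacent : ∀ a → ∃ λ b → Adj (TCG G Ψ) a b
  partner-adjacent a with partner a
  ... | b , _ , a~b = b , a~b

  coverFamily : CoverFamily (TCG G Ψ) (maxDegree G)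
  coverFamily = record
    { Index  = Fin n
    ; Meets  = Meets
    ; meets? = meets?
    ; small  = λ v → ≤-trans (few v) (degree≤maxDegree G v)
    ; covers = λ v {a} {b} a~b → split (TotalCoalition.union a~b v)
    -- Having a partner, class `a` is not total dominating; by decidability an explicit vertex
    -- without a neighbour in it can be found.
    ; missed = λ a → ¬∀⟶∃¬ n (λ v → Meets v a) (λ v → meets? v a) (not-dominating a)
    ; joined = λ {a} {b} a≢b meets →
        totalCoalition (disjoint a b a≢b) (not-dominating a) (not-dominating b) λ v →
          [ (λ (u , u∈a , v~u) → u , x∈p∪q⁺ (inj₁ u∈a) , v~u)
          , (λ (u , u∈b , v~u) → u , x∈p∪q⁺ (inj₂ u∈b) , v~u) ]′ (meets v)
    }
    where
    Meets : Fin n → Fin k → Set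
    Meets v a = ∃ λ u → u ∈ class a × Adj G v u

    meets? : ∀ v → Decidable (Meets v)
    meets? v a = any? (λ u → (u ∈? class a) ×-dec adj? G v u)

    not-dominating : ∀ a → ¬ TotalDominating G (class a)
    not-dominating a = TotalCoalition.notLeft (proj₂ (partner-adjacent a))

    split : ∀ {v a b} → (∃ λ u → u ∈ class a ∪ class b × Adj G v u) → Meets v a ⊎ Meets v b
    split {a = a} {b} (u , u∈ , v~u) =
      Sum.map (λ u∈a → u , u∈a , v~u) (λ u∈b → u , u∈b , v~u) (x∈p∪q⁻ (class a) (class b) u∈)

    classOf : Fin n → Fin k
    classOf u = proj₁ (covers u)

    classOf-unique : ∀ {u a} → u ∈ class a → classOf u ≡ a
    classOf-unique {u} {a} u∈a = decidable-stable (classOf u ≟ a) λ ≢a →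
      disjoint (classOf u) a ≢a (u , x∈p∩q⁺ (proj₂ (covers u) , u∈a))

    -- Each neighbour of `v` lies in one class only, so the classes met are at most as many as the
    -- neighbours.
    few : ∀ v → count (meets? v) ≤ degree G v
    few v = begin
      count (meets? v)                                              ≤⟨ sum-mono-≤ pointwise ⟩
      sum (λ a → count (λ u → adj? G v u ×-dec (classOf u ≟ a)))    ≡⟨ count-fibres (adj? G v) classOf ⟨
      count (adj? G v)                                              ≡⟨ ∣tabulate∣≡count (adj? G v) ⟨
      degree G v                                                    ∎
      where
      open ≤-Reasoning
      pointwise : ∀ a → indicator (meets? v a) ≤ count (λ u → adj? G v u ×-dec (classOf u ≟ a))
      pointwise a with meets? v a
      ... | yes (u , u∈a , v~u) = count-some (λ u → adj? G v u ×-dec (classOf u ≟ a)) (v~u , classOf-unique u∈a)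
      ... | no _                = z≤n

-- Arithmetic of the extremal values

-- Putting d = 1 + m - t gives t q = (1 + m)(2 + m) - d (d + 1), so the lower bound on the product
-- forces d = 0.
balanced-≤ : ∀ m t q → t + q ≡ 3 + 2 * m → (1 + m) * (2 + m) ≤ t * q → t ≤ 1 + m →
             t ≡ 1 + m × q ≡ 2 + m
balanced-≤ m t q t+q≡ ≤tq t≤ = t≡ , q≡
  where
  d = 1 + m ∸ t
  d+t≡ : d + t ≡ 1 + m
  d+t≡ = m∸n+n≡m t≤
  q≡′ : q ≡ 1 + 2 * d + t
  q≡′ = +-cancelˡ-≡ t q _ (trans t+q≡ (trans (lhs m) (trans (cong (λ x → 1 + (x + x)) (sym d+t≡)) (rhs d t))))
    where
    lhs : ∀ m → 3 + 2 * m ≡ 1 + ((1 + m) + (1 + m))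
    lhs = solve-∀
    rhs : ∀ d t → 1 + ((d + t) + (d + t)) ≡ t + (1 + 2 * d + t)
    rhs = solve-∀
  d≡0 : d ≡ 0
  d≡0 = n≤0⇒n≡0 (≤-trans (m≤m+n d (d * d)) (+-cancelˡ-≤ (t * q) _ 0 (begin
    t * q + (d + d * d)                    ≡⟨ cong (λ x → t * x + (d + d * d)) q≡′ ⟩
    t * (1 + 2 * d + t) + (d + d * d)      ≡⟨ expand d t ⟩
    (d + t) * (1 + (d + t))                ≡⟨ cong (λ x → x * (1 + x)) d+t≡ ⟩
    (1 + m) * (2 + m)                      ≤⟨ ≤tq ⟩
    t * q                                  ≡⟨ +-identityʳ (t * q) ⟨
    t * q + 0                              ∎)))
    where
    open ≤-Reasoning
    expand : ∀ d t → t * (1 + 2 * d + t) + (d + d * d) ≡ (d + t) * (1 + (d + t))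
    expand = solve-∀
  t≡ : t ≡ 1 + m
  t≡ = trans (cong (_+ t) (sym d≡0)) d+t≡
  q≡ : q ≡ 2 + m
  q≡ = trans q≡′ (cong₂ (λ x y → 1 + 2 * x + y) d≡0 t≡)

balanced : ∀ m t q → t + q ≡ 3 + 2 * m → (1 + m) * (2 + m) ≤ t * q →
           1 + m ≤ t × 1 + m ≤ q × t * q ≡ (1 + m) * (2 + m)
balanced m t q t+q≡ ≤tq with t ≤? 1 + m
... | yes t≤ with balanced-≤ m t q t+q≡ ≤tq t≤
...   | refl , refl = ≤-refl , n≤1+n (1 + m) , refl
balanced m t q t+q≡ ≤tq | no t≰
  -- Now t is at least 2 + m, so q is at most 1 + m and the roles of `t` and `q` are exchanged.
  with balanced-≤ m q t (trans (+-comm q t) t+q≡) (≤-trans ≤tq (≤-reflexive (*-comm t q))) q≤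
  where
  q≤ : q ≤ 1 + m
  q≤ = +-cancelˡ-≤ (2 + m) q (1 + m) (≤-trans (+-monoˡ-≤ q (≰⇒> t≰)) (≤-reflexive (trans t+q≡ (sum≡ m))))
    where
    sum≡ : ∀ m → 3 + 2 * m ≡ (2 + m) + (1 + m)
    sum≡ = solve-∀
... | refl , refl = n≤1+n (1 + m) , ≤-refl , *-comm (2 + m) (1 + m)

-- The square of 1 + 2 m is 4 (m m + m) + 1, so the floor discards exactly the remainder 1.
bound-odd : ∀ m → (1 + 2 * m) ^ 2 / 4 + (1 + 2 * m) + 1 ≡ (1 + m) * (2 + m)
bound-odd m = begin
  (1 + 2 * m) ^ 2 / 4 + (1 + 2 * m) + 1            ≡⟨ cong (λ x → x / 4 + (1 + 2 * m) + 1) (square m) ⟩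
  (1 + (m * m + m) * 4) / 4 + (1 + 2 * m) + 1      ≡⟨ cong (λ x → x + (1 + 2 * m) + 1) quotient ⟩
  m * m + m + (1 + 2 * m) + 1                      ≡⟨ factor m ⟩
  (1 + m) * (2 + m)                                ∎
  where
  open ≡-Reasoning
  square : ∀ m → (1 + 2 * m) * ((1 + 2 * m) * 1) ≡ 1 + (m * m + m) * 4
  square = solve-∀
  factor : ∀ m → m * m + m + (1 + 2 * m) + 1 ≡ (1 + m) * (2 + m)
  factor = solve-∀
  quotient : (1 + (m * m + m) * 4) / 4 ≡ m * m + m
  quotient = trans (+-distrib-/-∣ʳ 1 {d = 4} (n∣m*n (m * m + m))) (m*n/n≡m (m * m + m) 4)

-- The extremal structure and the isomorphism

module Structure (G : Graph n) (m : ℕ) (2≤m : 2 ≤ m) (Δ≡ : maxDegree G ≡ 1 + 2 * m)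
                 (k≡ : k ≡ (1 + m) * (2 + m)) (Ψ : TotalCoalitionPartition G k)
                 (ν≡t : IsMatchingNumber (TCG G Ψ) t) where

  forest : StarForest (TCG G Ψ) t
  forest = MaximumMatching.starForest (partner-adjacent G Ψ) (proj₁ ν≡t)
             (λ M → <-irrefl refl (proj₂ ν≡t _ M))

  open CoveredStars forest (coverFamily G Ψ)

  q : ℕ
  q = 3 + 2 * m ∸ t

  t+size≤ : ∀ i → t + size i ≤ 3 + 2 * m
  t+size≤ i = ≤-trans (t+size≤2+Δ i) (≤-reflexive (cong (2 +_) Δ≡))

  -- Makes the truncated subtraction in `q` exact. The size bound needs a star to apply to; without
  -- stars, `t` is 0.
  t≤ : t ≤ 3 + 2 * m
  t≤ = nonempty-≤ (λ i → ≤-trans (m≤m+n t (size i)) (t+size≤ i))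
    where
    nonempty-≤ : ∀ {t N} → (Fin t → t ≤ N) → t ≤ N
    nonempty-≤ {zero}  f = z≤n
    nonempty-≤ {suc t} f = f zero

  t+q≡ : t + q ≡ 3 + 2 * m
  t+q≡ = m+[n∸m]≡n t≤

  size≤q : ∀ i → size i ≤ q
  size≤q i = +-cancelˡ-≤ t (size i) q (≤-trans (t+size≤ i) (≤-reflexive (sym t+q≡)))

  sizes : 1 + m ≤ t × 1 + m ≤ q × t * q ≡ (1 + m) * (2 + m)
  sizes = balanced m t q t+q≡
    (≤-trans (≤-reflexive (trans (sym k≡) (sym sum-size))) (sum-≤ size≤q))

  open Extremal (trans t+q≡ (cong (2 +_) (sym Δ≡)))
    (sum-extremal size≤q (trans sum-size (trans k≡ (sym (proj₂ (proj₂ sizes))))))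
    (≤-trans (s≤s 2≤m) (proj₁ sizes)) (≤-trans (s≤s 2≤m) (proj₁ (proj₂ sizes)))
    public

theorem5p2 : (n : ℕ) (G : Graph n) → IsolateFree G →
    maxDegree G % 2 ≡ 1 → maxDegree G ≥ 5 →
    (k : ℕ) → IsTotalCoalitionNumber G k →
    k ≡ maxDegree G ^ 2 / 4 + maxDegree G + 1 →
    (Ψ Ψ′ : TotalCoalitionPartition G k) →
    (s s′ : ℕ) → IsMatchingNumber (TCG G Ψ) s → IsMatchingNumber (TCG G Ψ′) s′ →
    s ≡ s′ →
    TCG G Ψ ≅ TCG G Ψ′
theorem5p2 n G _ odd Δ≥5 k _ k≡ Ψ Ψ′ s .s ν≡s ν≡s′ refl = record
  { bijection = proj₁ relabelling
  ; adjacency = λ a b → ⇔.trans (S.adjacent⇔corona a b) (⇔.trans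
      (subst₂ (λ x y → Corona (S.label a) (S.label b) ⇔ Corona x y)
        (sym (proj₂ relabelling a)) (sym (proj₂ relabelling b)) ⇔.refl)
      (⇔.sym (S′.adjacent⇔corona _ _)))
  }
  where
  m = maxDegree G / 2
  Δ≡ : maxDegree G ≡ 1 + 2 * m
  Δ≡ = trans (m≡m%n+[m/n]*n (maxDegree G) 2) (cong₂ _+_ odd (*-comm m 2))
  2≤m : 2 ≤ m
  -- From 5 ≤ 1 + 2 m; this later gives both `3≤t` and `3≤q`.
  2≤m = *-cancelˡ-≤ 2 (≤-pred (≤-trans Δ≥5 (≤-reflexive Δ≡)))
  k≡′ : k ≡ (1 + m) * (2 + m)
  k≡′ = trans k≡ (trans (cong (λ Δ → Δ ^ 2 / 4 + Δ + 1) Δ≡) (bound-odd m))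
  module S  = Structure G m 2≤m Δ≡ k≡′ Ψ ν≡s
  module S′ = Structure G m 2≤m Δ≡ k≡′ Ψ′ ν≡s′
  -- Both partitions share `m` and the matching number `s`, hence the same `q`, so every label
  -- occurs equally often in both.
  relabelling = equal-fibres⇒permutation _≟ᴸ_ S.label S′.label
    (λ (i , x) → trans (S.count-label i x) (sym (S′.count-label i x)))
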